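{- Let $k \in \{4,5\}$ and let $G$ be a finite simple $3$-connected $k$-$\gamma_c$-vertex critical claw-free graph. Then $G$ is Hamiltonian.
   Context: A connected dominating set of a graph $G$ is a set $D \subseteq V(G)$ such that every vertex outside $D$ has a neighbor in $D$ and the induced subgraph $G[D]$ is connected; $\gamma_c(G)$ is the minimum size of a connected dominating set. A graph $G$ is $k$-$\gamma_c$-vertex critical if $\gamma_c(G)=k$ and $\gamma_c(G-v)<k$ for every vertex $v$ of $G$. A graph is claw-free if it has no induced subgraph isomorphic to $K_{1,3}$. -}

module Defs where

open import Data.Nat using (ℕ; suc; _<_; _≤_)
open import Data.Bool using (Bool; true; false)
open import Data.Fin using (Fin; punchIn)
open import Data.Fin.Subset using (Subset; _∈_; _∉_; _⊆_; ∁; ∣_∣; Nonempty)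
open import Data.List using (List; []; _∷_; length)
open import Data.List.Membership.Propositional using () renaming (_∈_ to _∈ₗ_)
open import Data.List.Relation.Unary.Unique.Propositional using (Unique)
open import Data.Product using (Σ; ∃; _×_; _,_)
open import Relation.Binary.PropositionalEquality using (_≡_; _≢_)
open import Relation.Nullary using (¬_)

record Graph (n : ℕ) : Set where
  field
    adj   : Fin n → Fin n → Bool
    sym   : ∀ u v → adj u v ≡ adj v u
    loopless : ∀ v → adj v v ≡ false
open Graph public

Adj : ∀ {n} → Graph n → Fin n → Fin n → Set
Adj G u v = adj G u v ≡ true

_-ᵥ_ : ∀ {n} → Graph (suc n) → Fin (suc n) → Graph n
adj      (G -ᵥ v) i j = adj G (punchIn v i) (punchIn v j)
sym      (G -ᵥ v) i j = sym G (punchIn v i) (punchIn v j)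
loopless (G -ᵥ v) i   = loopless G (punchIn v i)

data PathIn {n} (G : Graph n) (D : Subset n) : Fin n → Fin n → Set where
  here  : ∀ {u} → u ∈ D → PathIn G D u u
  step  : ∀ {u v w} → u ∈ D → Adj G u v → PathIn G D v w → PathIn G D u w

InducedConnected : ∀ {n} → Graph n → Subset n → Set
InducedConnected G D = Nonempty D × (∀ u w → u ∈ D → w ∈ D → PathIn G D u w)

Dominating : ∀ {n} → Graph n → Subset n → Set
Dominating G D = ∀ v → v ∉ D → ∃ λ u → u ∈ D × Adj G u v

IsConnectedDominatingSet : ∀ {n} → Graph n → Subset n → Set
IsConnectedDominatingSet G D = Dominating G D × InducedConnected G D

ConnDomNumber : ∀ {n} → Graph n → ℕ → Set
ConnDomNumber G k =
  (∃ λ D → IsConnectedDominatingSet G D × ∣ D ∣ ≡ k) ×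
  (∀ D → IsConnectedDominatingSet G D → k ≤ ∣ D ∣)

VertexCritical : ∀ {n} → ℕ → Graph (suc n) → Set
VertexCritical k G =
  ConnDomNumber G k × (∀ v → ∃ λ m → m < k × ConnDomNumber (G -ᵥ v) m)

KConnected : ∀ {n} → ℕ → Graph n → Set
KConnected {n} k G = k < n × (∀ S → ∣ S ∣ < k → InducedConnected G (∁ S))

ClawFree : ∀ {n} → Graph n → Set
ClawFree G = ∀ a b c d →
  ¬ (Adj G a b × Adj G a c × Adj G a d ×
     b ≢ c × b ≢ d × c ≢ d ×
     adj G b c ≡ false × adj G b d ≡ false × adj G c d ≡ false)

data ConsecAdj {n} (G : Graph n) : List (Fin n) → Set where
  nil  : ConsecAdj G []
  one  : ∀ x → ConsecAdj G (x ∷ [])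
  cons : ∀ {x y xs} → Adj G x y → ConsecAdj G (y ∷ xs) → ConsecAdj G (x ∷ y ∷ xs)

last′ : ∀ {A : Set} → A → List A → A
last′ x []       = x
last′ x (y ∷ ys) = last′ y ys

Hamiltonian : ∀ {n} → Graph n → Set
Hamiltonian {n} G = ∃ λ x → ∃ λ xs →
  Unique (x ∷ xs) × (∀ v → v ∈ₗ (x ∷ xs)) × 3 ≤ length (x ∷ xs) ×
  ConsecAdj G (x ∷ xs) × Adj G (last′ x xs) x

{-# OPTIONS --safe #-}
module Submission where

-- Let C be a longest cycle, suppose h ∉ C, let H be the component of h in G − C, and call a vertex
-- of C attached if it has a neighbour in H; 3-connectivity yields three attached vertices.  For an
-- attached x let y(x) be the first vertex after x on C that is not adjacent to x.  As G is
-- claw-free, the vertices between x and y(x) form a clique together with x and its predecessor, so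
-- they can be visited in front of x instead; rerouting C through H then shows that the y(x) are
-- distinct, independent, and adjacent to no attached vertex.
--
-- Criticality gives for each vertex v a connected set D of at most k − 1 ≤ 4 vertices that dominates
-- every vertex but v.  In a claw-free graph an independent set dominated by a connected set D, none
-- of whose members is dominated by a certain z ∈ D, has fewer than |D| elements.  Take v attached:
-- D dominates h and the y(x), so it contains an attached z, which is neither equal nor adjacent to
-- v.  If z is not among x₁, x₂, x₃, then y(x₁), y(x₂), y(x₃), y(z) are too many; if some
-- w ∈ {x₁, x₂, x₃} other than v and z is not adjacent to z, then y(x₁), y(x₂), y(x₃), w are too
-- many.  So each of x₁, x₂, x₃ has a non-neighbour among them that is adjacent to the third, which
-- is impossible for three vertices.

open import Defs
open import Data.Bool using (true; false)
open import Data.Bool.Properties as Bool using (¬-not)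
open import Data.Empty using (⊥; ⊥-elim)
open import Data.Fin using (Fin; zero; suc; punchIn)
open import Data.Fin.Properties using (any?; _≟_; punchIn-punchOut; injective⇒≤)
open import Data.Fin.Subset
  using (Subset; _∈_; _∉_; ∣_∣; ⁅_⁆; _∪_; inside; outside) renaming (⊥ to ∅)
open import Data.Fin.Subset.Properties
  using (∣⊥∣≡0; ∉⊥; ∣⁅x⁆∣≡1; x∈⁅x⁆; x∈⁅y⁆⇒x≡y; x∈p⇒∣p-x∣<∣p∣; x∈p∧x≢y⇒x∈p-y;
         x∈p∪q⁻; x∈p∪q⁺; x∉p⇒x∈∁p; x∈∁p⇒x∉p; ∈⊤; ∣⊤∣≡n)
  renaming (_∈?_ to _∈ₛ?_)
open import Data.List using (List; []; _∷_; _++_; length; reverse; [_]; filter)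
open import Data.List.Membership.DecPropositional using (_∈?_)
open import Data.List.Membership.Propositional using (lose) renaming (_∈_ to _∈ₗ_; _∉_ to _∉ₗ_)
open import Data.List.Membership.Propositional.Properties using (∈-++⁺ˡ; ∈-++⁺ʳ; ∈-++⁻; ∈-∃++)
open import Data.List.Membership.Setoid.Properties using (index-injective)
open import Data.List.Properties
  using (∷-injective; ++-assoc; ++-identityʳ; unfold-reverse; length-++; filter-all)
open import Data.List.Relation.Binary.Permutation.Propositional
  using (_↭_; ↭-refl; ↭-sym; ↭-trans; ↭-reflexive; prep; ↭⇒↭ₛ)
open import Data.List.Relation.Binary.Permutation.Propositional.Properties
  using (∈-resp-↭; ↭-length; ↭-reverse; ++-comm; ++⁺ˡ; ++⁺ʳ; ++-commutativeMonoid)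
import Data.List.Relation.Binary.Permutation.Setoid.Properties as Permₛ
open import Data.List.Relation.Unary.All as All using (All; []; _∷_)
import Data.List.Relation.Unary.All.Properties as All
open import Data.List.Relation.Unary.AllPairs using (AllPairs; []; _∷_)
import Data.List.Relation.Unary.AllPairs.Properties as AllPairs
open import Data.List.Relation.Unary.Any as Any using (Any; here; there)
open import Data.List.Relation.Unary.Unique.Propositional using (Unique)
import Data.List.Relation.Unary.Unique.DecPropositional as UniqueDec
import Data.List.Relation.Unary.Unique.Propositional.Properties as Unique
open import Data.Nat using (ℕ; zero; suc; _+_; _≤_; _<_; z≤n; s≤s)
import Data.Nat.Properties as ℕ
open import Data.Product using (∃; ∃₂; _×_; _,_; proj₁; proj₂)
open import Data.Sum as Sum using (_⊎_; inj₁; inj₂)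
open import Data.Vec using (insertAt; []; _∷_)
open import Data.Vec.Properties using (insertAt-lookup; insertAt-punchIn; lookup⇒[]=; []=⇒lookup)
open import Function using (_∘_; case_of_)
open import Relation.Binary.PropositionalEquality as ≡ using (_≡_; _≢_; refl; cong; subst)
open import Relation.Nullary using (¬_; Dec; yes; no; contradiction)
open import Relation.Nullary.Decidable
  using (_×-dec_; _⊎-dec_; ¬?; map′; decidable-stable; ¬¬-excluded-middle)
open import Relation.Unary using (Decidable)

-- Lists: uniqueness and comparison of splittings

Unique-resp-↭ : ∀ {A : Set} {l m : List A} → l ↭ m → Unique l → Unique m
Unique-resp-↭ p = Permₛ.Unique-resp-↭ (≡.setoid _) (↭⇒↭ₛ p)

unique-++-≢ : ∀ {A : Set} l {m : List A} {u v} → Unique (l ++ m) → u ∈ₗ l → v ∈ₗ m → u ≢ v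
unique-++-≢ (_ ∷ l) (x∉ ∷ _) (here refl) v∈ = All.lookup x∉ (∈-++⁺ʳ l v∈)
unique-++-≢ (_ ∷ l) (_ ∷ un) (there u∈)  v∈ = unique-++-≢ l un u∈ v∈

-- Places a run `a` and its end `y` before the other attached vertex `z`, which is none of them.
prefix-before : ∀ {A : Set} a {y : A} {r} b {z e} →
  a ++ y ∷ r ≡ b ++ z ∷ e → z ∉ₗ a → z ≢ y → ∃ λ b′ → b ≡ a ++ y ∷ b′
prefix-before []      []      refl z∉ z≢ = contradiction refl z≢
prefix-before []      (_ ∷ b) refl z∉ z≢ = b , refl
prefix-before (_ ∷ a) []      refl z∉ z≢ = contradiction (here refl) z∉
prefix-before (_ ∷ a) (_ ∷ b) eq   z∉ z≢ with ∷-injective eq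
... | refl , eq′ with prefix-before a b eq′ (z∉ ∘ there) z≢
... | b′ , refl = b′ , refl

-- Tells which of two attached vertices comes first in `C`, with `b` the stretch between them.
compare-splits : ∀ {A : Set} p {x : A} {q} p′ {x′ q′} → p ++ x ∷ q ≡ p′ ++ x′ ∷ q′ → x ≢ x′ →
  (∃ λ b → p′ ≡ p ++ x ∷ b × q ≡ b ++ x′ ∷ q′) ⊎ (∃ λ b → p ≡ p′ ++ x′ ∷ b × q′ ≡ b ++ x ∷ q)
compare-splits []      []       refl x≢ = contradiction refl x≢
compare-splits []      (_ ∷ p′) refl x≢ = inj₁ (p′ , refl , refl)
compare-splits (_ ∷ p) []       refl x≢ = inj₂ (p , refl , refl)
compare-splits (_ ∷ p) (_ ∷ p′) eq   x≢ with ∷-injective eq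
... | refl , eq′ with compare-splits p p′ eq′ x≢
...   | inj₁ (b , refl , refl) = inj₁ (b , refl , refl)
...   | inj₂ (b , refl , refl) = inj₂ (b , refl , refl)

-- Walks and cycles

module Walks {N} (G : Graph N) where

  private
    V = Fin N
    _∈V?_ : (v : V) (l : List V) → Dec (v ∈ₗ l)
    _∈V?_ = _∈?_ _≟_

  Adj-sym : ∀ {u v} → Adj G u v → Adj G v u
  Adj-sym {u} {v} = ≡.trans (Graph.sym G v u)

  Adj? : ∀ u v → Dec (Adj G u v)
  Adj? u v = adj G u v Bool.≟ true

  Adj-irrefl : ∀ {v} → ¬ Adj G v v
  Adj-irrefl {v} e = case ≡.trans (≡.sym e) (loopless G v) of λ ()

  claw : ClawFree G → ∀ {a b c d} → Adj G a b → Adj G a c → Adj G a d →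
    b ≢ c → b ≢ d → c ≢ d → ¬ Adj G b c → ¬ Adj G b d → Adj G c d
  claw cf {a} {b} {c} {d} ab ac ad b≢c b≢d c≢d ¬bc ¬bd with Adj? c d
  ... | yes cd = cd
  ... | no ¬cd = ⊥-elim (cf a b c d
          (ab , ac , ad , b≢c , b≢d , c≢d , ¬-not ¬bc , ¬-not ¬bd , ¬-not ¬cd))

  infixr 5 _◂_
  infixr 5 _▸⟨_⟩_

  -- The list holds all visited vertices, both ends included. Joining two walks by an edge is then
  -- `++`, and a rerouted cycle is compared with `C` by permuting lists.
  data Walk : V → List V → V → Set where
    stop : ∀ u → Walk u [ u ] u
    _◂_  : ∀ {u v w l} → Adj G u v → Walk v l w → Walk u (u ∷ l) w

  _▸⟨_⟩_ : ∀ {u l v w m z} → Walk u l v → Adj G v w → Walk w m z → Walk u (l ++ m) z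
  stop _   ▸⟨ e ⟩ q = e ◂ q
  (f ◂ p) ▸⟨ e ⟩ q = f ◂ (p ▸⟨ e ⟩ q)

  reverseʷ : ∀ {u l v} → Walk u l v → Walk v (reverse l) u
  reverseʷ (stop u) = stop u
  reverseʷ (_◂_ {u} {v} {l = l} e p) =
    subst (λ m → Walk _ m u) (≡.sym (unfold-reverse u l)) (reverseʷ p ▸⟨ Adj-sym e ⟩ stop u)

  walk-start : ∀ {u x l v} → Walk u (x ∷ l) v → u ≡ x
  walk-start (stop _) = refl
  walk-start (_ ◂ _)  = refl

  start∈ : ∀ {u l v} → Walk u l v → u ∈ₗ l
  start∈ (stop _) = here refl
  start∈ (_ ◂ _)  = here refl

  end∈ : ∀ {u l v} → Walk u l v → v ∈ₗ l
  end∈ (stop _) = here refl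
  end∈ (_ ◂ p)  = there (end∈ p)

  split : ∀ {u} x l {y m w} → Walk u ((x ∷ l) ++ y ∷ m) w →
    ∃ λ v → Walk x (x ∷ l) v × Adj G v y × Walk y (y ∷ m) w
  split x [] (e ◂ p) with walk-start p
  ... | refl = x , stop x , e , p
  split x (z ∷ l) (e ◂ p) with walk-start p
  ... | refl with split z l p
  ... | v , p₁ , f , p₂ = v , e ◂ p₁ , f , p₂

  ClosedWalk : List V → Set
  ClosedWalk l = ∃₂ λ u v → Walk u l v × Adj G v u

  -- An edge walked back and forth counts as a cycle of length two, so the search for a longest
  -- cycle can start from any edge.
  Cycle : List V → Set
  Cycle l = ClosedWalk l × Unique l

  closed-∷ : ∀ {x l} → ClosedWalk (x ∷ l) → ∃ λ v → Walk x (x ∷ l) v × Adj G v x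
  closed-∷ (u , v , p , e) with walk-start p
  ... | refl = v , p , e

  closed-avoids : ∀ {l} → ClosedWalk l → ∀ x → ∃ λ c → c ∈ₗ l × c ≢ x
  closed-avoids (u , v , p , v~u) x with u ≟ x
  ... | no u≢x   = u , start∈ p , u≢x
  ... | yes refl = v , end∈ p , λ { refl → Adj-irrefl v~u }

  rotate : ∀ l m → ClosedWalk (l ++ m) → ClosedWalk (m ++ l)
  rotate []      m       c = subst ClosedWalk (≡.sym (++-identityʳ m)) c
  rotate (x ∷ l) []      c = subst ClosedWalk (++-identityʳ (x ∷ l)) c
  rotate (x ∷ l) (y ∷ m) c with closed-∷ c
  ... | v , p , e with split x l p
  ... | w , p₁ , f , p₂ = y , w , p₂ ▸⟨ e ⟩ p₁ , f

  walk? : ∀ x l → Dec (∃ λ v → Walk x (x ∷ l) v)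
  walk? x []      = yes (x , stop x)
  walk? x (y ∷ l) = map′
    (λ { (e , v , p) → v , e ◂ p })
    (λ { (v , e ◂ p) → case walk-start p of λ { refl → e , v , p } })
    (Adj? x y ×-dec walk? y l)

  -- For refuting closedness: `walk?` yields one end, and no other end could close the same list.
  end-unique : ∀ {u l v w} → Walk u l v → Walk u l w → v ≡ w
  end-unique (stop _) (stop _) = refl
  end-unique (_ ◂ p)  (_ ◂ q)  with aux p q
    where
    aux : ∀ {u u′ l v w} → Walk u l v → Walk u′ l w → u ≡ u′
    aux (stop _) (stop _) = refl
    aux (stop _) (_ ◂ _)  = refl
    aux (_ ◂ _)  (stop _) = refl
    aux (_ ◂ _)  (_ ◂ _)  = refl
  ... | refl = end-unique p q

  closedWalk? : Decidable ClosedWalk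
  closedWalk? []      = no λ { (_ , _ , () , _) }
  closedWalk? (x ∷ l) with walk? x l
  ... | no ¬p = no λ c → case closed-∷ c of λ { (v , p , _) → ¬p (v , p) }
  ... | yes (v , p) with Adj? v x
  ...   | yes e = yes (x , v , p , e)
  ...   | no ¬e = no λ c → case closed-∷ c of λ { (w , q , e) →
                    ¬e (subst (λ t → Adj G t x) (end-unique q p) e) }

  -- Loop erasure: if the new start `u` already lies on the simplified tail, the walk restarts from
  -- that occurrence.
  simplify : ∀ {u l v} → Walk u l v → ∃ λ m → Walk u m v × Unique m × (∀ {t} → t ∈ₗ m → t ∈ₗ l)
  simplify (stop u) = [ u ] , stop u , [] ∷ [] , λ t∈ → t∈
  simplify (_◂_ {u} {l = l} e p) with simplify p
  ... | m , q , un , m⊆l with u ∈V? m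
  ...   | no u∉m = u ∷ m , e ◂ q , All.¬Any⇒All¬ m u∉m ∷ un ,
                   λ { (here eq) → here eq ; (there t∈) → there (m⊆l t∈) }
  ...   | yes u∈m with suffix u∈m q un
    where
    suffix : ∀ {t w m v} → t ∈ₗ m → Walk w m v → Unique m →
      ∃ λ m′ → Walk t m′ v × Unique m′ × (∀ {s} → s ∈ₗ m′ → s ∈ₗ m)
    suffix (here refl) (stop _)  un       = _ , stop _ , un , λ s∈ → s∈
    suffix (here refl) (f ◂ r)   un       = _ , f ◂ r , un , λ s∈ → s∈
    suffix (there t∈)  (_ ◂ r)   (_ ∷ un) with suffix t∈ r un
    ... | m′ , r′ , un′ , sub = m′ , r′ , un′ , there ∘ sub
  ...     | m′ , q′ , un′ , sub = m′ , q′ , un′ , there ∘ m⊆l ∘ sub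

-- Runs after attached vertices of a longest cycle

first-satisfying : ∀ {A : Set} {P : A → Set} → Decidable P → ∀ {l} → Any P l →
  ∃ λ a → ∃ λ y → ∃ λ r → l ≡ a ++ y ∷ r × All (¬_ ∘ P) a × P y
first-satisfying P? {x ∷ l} any with P? x
... | yes px = [] , x , l , refl , [] , px
... | no ¬px with any
...   | here px = contradiction px ¬px
...   | there any′ with first-satisfying P? any′
...     | a , y , r , refl , ¬pa , py = x ∷ a , y , r , refl , ¬px ∷ ¬pa , py

-- `H` stands for the component of `h`. A link may be a single vertex, since two attached vertices
-- can share their neighbour in `H`.
module LongestCycle {N} (G : Graph N) (clawFree : ClawFree G)
  (C : List (Fin N)) (C-unique : Unique C) (C-longest : ∀ {l} → Walks.Cycle G l → length l ≤ length C)
  (H : Fin N → Set) (H-off : ∀ {u} → H u → u ∉ₗ C)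
  (H-link : ∀ {u v} → H u → H v → ∃ λ w → Walks.Walk G u w v × Unique w × (∀ {t} → t ∈ₗ w → t ∉ₗ C))
  where

  open Walks G

  private
    V = Fin N
    open import Algebra.Solver.CommutativeMonoid (++-commutativeMonoid {A = V}) using (solve; _⊜_; _⊕_)

  Att : V → Set
  Att x = x ∈ₗ C × ∃ λ u → H u × Adj G u x

  -- Otherwise x, a path through H, x′, T is a cycle longer than C.
  no-reroute : ∀ {x x′ P Q T t} → x ∷ P ++ x′ ∷ Q ↭ C → Att x → Att x′ →
    Walk x′ (x′ ∷ T) t → Adj G t x → T ↭ P ++ Q → ⊥
  no-reroute {x} {x′} {P} {Q} {T} {t} c↭ (_ , u , Hu , u~x) (_ , u′ , Hu′ , u′~x′) wT t~x T↭
    with H-link Hu Hu′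
  ... | w , wp , w-unique , w-off = ℕ.<⇒≱ longer (C-longest (closed , unique))
    where
    closed : ClosedWalk (x ∷ w ++ x′ ∷ T)
    closed = x , t , Adj-sym u~x ◂ (wp ▸⟨ u′~x′ ⟩ wT) , t~x
    perm : w ++ C ↭ x ∷ w ++ x′ ∷ T
    perm = ↭-trans (++⁺ˡ w (↭-sym c↭)) (↭-trans
      (solve 5 (λ x w x′ p q → w ⊕ x ⊕ p ⊕ x′ ⊕ q ⊜ x ⊕ w ⊕ x′ ⊕ p ⊕ q) ↭-refl [ x ] w [ x′ ] P Q)
      (prep x (++⁺ˡ w (prep x′ (↭-sym T↭)))))
    unique : Unique (x ∷ w ++ x′ ∷ T)
    unique = Unique-resp-↭ perm (Unique.++⁺ w-unique C-unique λ (t∈w , t∈C) → w-off t∈w t∈C)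
    w-nonempty : ∀ {w} → u ∈ₗ w → length C < length (w ++ C)
    w-nonempty {_ ∷ w} _ = s≤s (ℕ.≤-trans (ℕ.m≤n+m _ (length w)) (ℕ.≤-reflexive (≡.sym (length-++ w))))
    longer : length C < length (x ∷ w ++ x′ ∷ T)
    longer = subst (length C <_) (↭-length perm) (w-nonempty (start∈ wp))

  unsnoc : ∀ {u v l w} → Adj G u v → Walk v l w →
    ∃₂ λ m t → l ≡ m ++ [ w ] × Walk u (u ∷ m) t × Adj G t w
  unsnoc {u} e (stop w) = [] , u , refl , stop u , e
  unsnoc e (f ◂ p) with unsnoc f p
  ... | m , t , refl , q , g = _ ∷ m , t , refl , e ◂ q , g

  -- Otherwise a path through `H` could replace the edge from `v` to `u`.
  not-consecutive : ∀ {u l v} → Walk u l v → Adj G v u → l ↭ C → Att u → ¬ Att v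
  not-consecutive (stop _) e _ _ _ = Adj-irrefl e
  not-consecutive {u} {_} {v} (e ◂ p) _ l↭ attu attv with unsnoc e p
  ... | m , t , refl , q , g =
    no-reroute {P = []} (↭-trans (++-comm [ v ] (u ∷ m)) l↭) attv attu q g ↭-refl

  -- Otherwise `x` is the centre of a claw whose leaves are `c`, `d` and a neighbour of `x` in `H`.
  Att-clique : ∀ {x c d} → Att x → c ∈ₗ C → d ∈ₗ C → ¬ Att c → ¬ Att d →
    Adj G x c → Adj G x d → c ≢ d → Adj G c d
  Att-clique (_ , u , Hu , u~x) c∈ d∈ ¬c ¬d x~c x~d c≢d =
    claw clawFree (Adj-sym u~x) x~c x~d
      (λ { refl → H-off Hu c∈ }) (λ { refl → H-off Hu d∈ }) c≢d
      (λ u~c → ¬c (c∈ , u , Hu , u~c)) (λ u~d → ¬d (d∈ , u , Hu , u~d))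

  FreeNbr : V → V → Set
  FreeNbr x t = Adj G x t × ¬ Att t

  -- An attached `y` cannot follow `x` directly. If a run lies between them, the cycle from `x`
  -- through `H` to `y`, along `C` to the predecessor `v` of `x`, to the last run vertex `p′` and
  -- back along the run to `x` is longer; `v` and `p′` are adjacent as unattached neighbours of `x`.
  run-end-free : (∀ v → Dec (Att v)) → ∀ {x s a y r} → Att x → ClosedWalk (x ∷ s) → x ∷ s ↭ C →
    s ≡ a ++ y ∷ r → All (FreeNbr x) a → ¬ Att y
  run-end-free att? {x} {_} {[]} {y} {r} attx cw c↭ refl _ atty with closed-∷ cw
  ... | v , (e ◂ p) , f with walk-start p
  ...   | refl = not-consecutive (p ▸⟨ f ⟩ stop x) e (↭-trans (++-comm (y ∷ r) [ x ]) c↭) atty attx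
  run-end-free att? {x} {_} {a ∷ as} {y} {r} attx cw c↭ refl free atty with closed-∷ cw
  ... | v , (e ◂ p) , f with walk-start p
  ...   | refl with split a as p
  ...     | p′ , pa , g , py =
    no-reroute {P = a ∷ as} {Q = r} c↭ attx atty
      (py ▸⟨ v~p′ ⟩ reverseʷ pa) (Adj-sym e)
      (↭-trans (++⁺ˡ r (↭-reverse (a ∷ as))) (++-comm r (a ∷ as)))
    where
    p′∈ = end∈ pa
    v∈ = end∈ py
    p′-free = All.lookup free p′∈
    v~p′ = Att-clique attx (∈-resp-↭ c↭ (there (∈-++⁺ʳ (a ∷ as) v∈)))
      (∈-resp-↭ c↭ (there (∈-++⁺ˡ p′∈)))
      (not-consecutive (e ◂ p) f c↭ attx) (proj₂ p′-free) (Adj-sym f) (proj₁ p′-free)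
      (λ eq → unique-++-≢ (x ∷ a ∷ as) (Unique-resp-↭ (↭-sym c↭) C-unique) (there p′∈) v∈ (≡.sym eq))

  -- Read cyclically from `x`, the cycle is `x`, the nonempty run `a ∷ run`, then `y`. `position`
  -- cuts `C` itself, so that the places of different attached vertices can be compared.
  record Run (x : V) : Set where
    field
      {pre post run rest} : List V
      {a y} : V
      position : C ≡ pre ++ x ∷ post
      splits   : post ++ pre ≡ (a ∷ run) ++ y ∷ rest
      run-free : All (FreeNbr x) (a ∷ run)
      x≁y      : ¬ Adj G x y
      ¬att-y   : ¬ Att y

  y∈C : ∀ {x} (ρ : Run x) → Run.y ρ ∈ₗ C
  y∈C ρ = subst (Run.y ρ ∈ₗ_) (≡.sym position)
    (Sum.[ ∈-++⁺ʳ pre ∘ there , ∈-++⁺ˡ ]′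
      (∈-++⁻ post (subst (y ∈ₗ_) (≡.sym splits) (∈-++⁺ʳ (a ∷ run) (here refl)))))
    where open Run ρ

  -- The search stops at the first vertex that is attached or not adjacent to `x`, at the latest at
  -- `x′`; `run-end-free` then excludes the first alternative.
  run-of : (∀ v → Dec (Att v)) → ClosedWalk C → ∀ {x x′} → Att x → Att x′ → x ≢ x′ → Run x
  run-of att? cw {x} {x′} attx attx′ x≢x′ with ∈-∃++ (proj₁ attx)
  ... | pre , post , C≡ = build (first-satisfying bad? (Any.map (λ { refl → inj₂ attx′ }) x′∈))
    where
    bad? : ∀ t → Dec (¬ Adj G x t ⊎ Att t)
    bad? t = ¬? (Adj? x t) ⊎-dec att? t
    cw′ : ClosedWalk (x ∷ post ++ pre)
    cw′ = rotate pre (x ∷ post) (subst ClosedWalk C≡ cw)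
    c↭ : x ∷ post ++ pre ↭ C
    c↭ = ↭-trans (++-comm (x ∷ post) pre) (↭-reflexive (≡.sym C≡))
    x′∈ : x′ ∈ₗ post ++ pre
    x′∈ with ∈-resp-↭ (↭-sym c↭) (proj₁ attx′)
    ... | here eq = contradiction (≡.sym eq) x≢x′
    ... | there x′∈ = x′∈
    build : (∃ λ a → ∃ λ y → ∃ λ r → post ++ pre ≡ a ++ y ∷ r ×
             All (λ t → ¬ (¬ Adj G x t ⊎ Att t)) a × (¬ Adj G x y ⊎ Att y)) → Run x
    build (a , y , r , eq , ¬bads , bad) = finish a eq free
      where
      free : All (FreeNbr x) a
      free = All.map (λ {t} ¬bad → decidable-stable (Adj? x t) (¬bad ∘ inj₁) , ¬bad ∘ inj₂) ¬bads
      ¬atty = run-end-free att? attx cw′ c↭ eq free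
      ¬x~y : ¬ Adj G x y
      ¬x~y x~y = Sum.[ (λ ¬x~y → ¬x~y x~y) , ¬atty ] bad
      finish : ∀ a → post ++ pre ≡ a ++ y ∷ r → All (FreeNbr x) a → Run x
      -- With an empty run `y` would be the successor of `x`, hence adjacent to it.
      finish [] eq _ with subst (ClosedWalk ∘ (x ∷_)) eq cw′
      ... | cy with closed-∷ cy
      ...   | _ , (e ◂ p) , _ with walk-start p
      ...     | refl = contradiction e ¬x~y
      finish (_ ∷ _) eq free = record
        { position = C≡ ; splits = eq ; run-free = free ; x≁y = ¬x~y ; ¬att-y = ¬atty }

  -- The cycle is cut at two attached vertices with both runs in view. Each claim is proved from the
  -- side of `x`; rotating the cycle gives the side of `x′`.
  module Opposite {x x′ a b y y′ : V} {as bs r r′ : List V}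
    (cw : ClosedWalk (x ∷ ((a ∷ as) ++ y ∷ r) ++ x′ ∷ (b ∷ bs) ++ y′ ∷ r′))
    (c↭ : x ∷ ((a ∷ as) ++ y ∷ r) ++ x′ ∷ (b ∷ bs) ++ y′ ∷ r′ ↭ C)
    (attx : Att x) (attx′ : Att x′)
    (free : All (FreeNbr x) (a ∷ as)) (free′ : All (FreeNbr x′) (b ∷ bs))
    (¬att-y′ : ¬ Att y′)
    where

    private
      P = (a ∷ as) ++ y ∷ r
      Q = (b ∷ bs) ++ y′ ∷ r′

      unique : Unique (x ∷ P ++ x′ ∷ Q)
      unique = Unique-resp-↭ (↭-sym c↭) C-unique

      P⊆C : ∀ {t} → t ∈ₗ P → t ∈ₗ C
      P⊆C = ∈-resp-↭ c↭ ∘ there ∘ ∈-++⁺ˡ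

      Q⊆C : ∀ {t} → t ∈ₗ Q → t ∈ₗ C
      Q⊆C = ∈-resp-↭ c↭ ∘ there ∘ ∈-++⁺ʳ P ∘ there

      P≢Q : ∀ {s t} → s ∈ₗ P → t ∈ₗ Q → s ≢ t
      P≢Q s∈ t∈ = unique-++-≢ (x ∷ P) unique (there s∈) (there t∈)

    -- `a′` and `b′` are the last vertices of the two runs; `p′` and `q′` are the predecessors of
    -- `x′` and `x`.
    record Pieces : Set where
      field
        {a′ b′ p′ q′} : V
        arc-a : Walk a (a ∷ as) a′
        arc-y : Walk y (y ∷ r) p′
        arc-b : Walk b (b ∷ bs) b′
        arc-y′ : Walk y′ (y′ ∷ r′) q′
        x~a : Adj G x a
        a′~y : Adj G a′ y
        p′~x′ : Adj G p′ x′
        x′~b : Adj G x′ b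
        b′~y′ : Adj G b′ y′
        q′~x : Adj G q′ x

    pieces : Pieces
    pieces with closed-∷ cw
    ... | _ , (e ◂ p) , q′~x with walk-start p
    ...   | refl with split a (as ++ y ∷ r) p
    ...     | _ , p₁ , p′~x′ , (f ◂ p₂) with walk-start p₂
    ...       | refl with split a as p₁ | split b bs p₂
    ...         | _ , wa , a′~y , wy | _ , wb , b′~y′ , wy′ = record
      { arc-a = wa ; arc-y = wy ; arc-b = wb ; arc-y′ = wy′ ; x~a = e ; a′~y = a′~y
      ; p′~x′ = p′~x′ ; x′~b = f ; b′~y′ = b′~y′ ; q′~x = q′~x }

    open Pieces pieces

    private
      a∈P : a ∈ₗ P
      a∈P = here refl

      a′-free : FreeNbr x a′
      a′-free = All.lookup free (end∈ arc-a)

      b′-free : FreeNbr x′ b′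
      b′-free = All.lookup free′ (end∈ arc-b)

      p′∈P : p′ ∈ₗ P
      p′∈P = ∈-++⁺ʳ (a ∷ as) (end∈ arc-y)

      b′∈Q : b′ ∈ₗ Q
      b′∈Q = ∈-++⁺ˡ (end∈ arc-b)

      y′∈Q : y′ ∈ₗ Q
      y′∈Q = ∈-++⁺ʳ (b ∷ bs) (here refl)

      q′∈Q : q′ ∈ₗ Q
      q′∈Q = ∈-++⁺ʳ (b ∷ bs) (end∈ arc-y′)

      arc-P : Walk a P p′
      arc-P = arc-a ▸⟨ a′~y ⟩ arc-y

      arc-xP : Walk x (x ∷ P) p′
      arc-xP = x~a ◂ arc-P

      arc-x′Q : Walk x′ (x′ ∷ Q) q′
      arc-x′Q = x′~b ◂ (arc-b ▸⟨ b′~y′ ⟩ arc-y′)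

      ¬att-q′ : ¬ Att q′
      ¬att-q′ = not-consecutive (arc-xP ▸⟨ p′~x′ ⟩ arc-x′Q) q′~x c↭ attx

      ¬att-p′ : ¬ Att p′
      ¬att-p′ = not-consecutive (arc-x′Q ▸⟨ q′~x ⟩ arc-xP) p′~x′
        (↭-trans (++-comm (x′ ∷ Q) (x ∷ P)) c↭) attx′

      -- Both are unattached neighbours of `x′`, so its run can be visited between `x′` and its
      -- predecessor; `q′~a` does the same at `x`.
      b′~p′ : Adj G b′ p′
      b′~p′ = Att-clique attx′ (Q⊆C b′∈Q) (P⊆C p′∈P) (proj₂ b′-free) ¬att-p′
        (proj₁ b′-free) (Adj-sym p′~x′) (P≢Q p′∈P b′∈Q ∘ ≡.sym)

      q′~a : Adj G q′ a
      q′~a = Att-clique attx (Q⊆C q′∈Q) (P⊆C a∈P) ¬att-q′ (proj₂ (All.head free))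
        (Adj-sym q′~x) x~a (P≢Q a∈P q′∈Q ∘ ≡.sym)

    -- Otherwise x, H, x′ b...b′, p′...y, y′...q′, a...a′ and back to x is a longer cycle.
    y≁y′ : ¬ Adj G y y′
    y≁y′ y~y′ = no-reroute {P = P} {Q = Q} c↭ attx attx′
      (x′~b ◂ (arc-b ▸⟨ b′~p′ ⟩ (reverseʷ arc-y ▸⟨ y~y′ ⟩ (arc-y′ ▸⟨ q′~a ⟩ arc-a))))
      (Adj-sym (proj₁ a′-free))
      (↭-trans (++⁺ˡ (b ∷ bs) (++⁺ʳ ((y′ ∷ r′) ++ a ∷ as) (↭-reverse (y ∷ r))))
        (solve 4 (λ a y b y′ → b ⊕ y ⊕ y′ ⊕ a ⊜ (a ⊕ y) ⊕ (b ⊕ y′)) ↭-refl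
          (a ∷ as) (y ∷ r) (b ∷ bs) (y′ ∷ r′)))

    -- Such an edge would make `a` adjacent to `y′`, and x, H, x′ b...b′, p′...a, y′...q′ and back
    -- to x would be a longer cycle.
    x≁y′ : ¬ Adj G x y′
    x≁y′ x~y′ = no-reroute {P = P} {Q = Q} c↭ attx attx′
      (x′~b ◂ (arc-b ▸⟨ b′~p′ ⟩ (reverseʷ arc-P ▸⟨ a~y′ ⟩ arc-y′))) q′~x
      (↭-trans (++⁺ˡ (b ∷ bs) (++⁺ʳ (y′ ∷ r′) (↭-reverse P)))
        (solve 3 (λ p b y′ → b ⊕ p ⊕ y′ ⊜ p ⊕ (b ⊕ y′)) ↭-refl P (b ∷ bs) (y′ ∷ r′)))
      where
      a~y′ : Adj G a y′
      a~y′ = Att-clique attx (P⊆C a∈P) (Q⊆C y′∈Q) (proj₂ (All.head free)) ¬att-y′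
        x~a x~y′ (P≢Q a∈P y′∈Q)

    y≢y′ : y ≢ y′
    y≢y′ = P≢Q (∈-++⁺ʳ (a ∷ as) (here refl)) y′∈Q

  Separated : ∀ {x x′} → Run x → Run x′ → Set
  Separated {x} {x′} ρ ρ′ = Run.y ρ ≢ Run.y ρ′ × ¬ Adj G (Run.y ρ) (Run.y ρ′) ×
    ¬ Adj G x (Run.y ρ′) × ¬ Adj G x′ (Run.y ρ)

  separated-sym : ∀ {x x′} (ρ : Run x) (ρ′ : Run x′) → Separated ρ ρ′ → Separated ρ′ ρ
  separated-sym _ _ (y≢y′ , y≁y′ , x≁y′ , x′≁y) = y≢y′ ∘ ≡.sym , y≁y′ ∘ Adj-sym , x′≁y , x≁y′

  -- `b` leads from `x` to `x′`, and `e` from `x′` back to `x`. Runs and their ends contain no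
  -- attached vertex, so each fits inside its own stretch, as `Opposite` requires.
  separated-ordered : ClosedWalk C → ∀ {x x′} → Att x → Att x′ → x ≢ x′ →
    (ρ : Run x) (ρ′ : Run x′) → ∀ b →
    Run.pre ρ′ ≡ Run.pre ρ ++ x ∷ b → Run.post ρ ≡ b ++ x′ ∷ Run.post ρ′ → Separated ρ ρ′
  separated-ordered cw {x} {x′} attx attx′ x≢x′ ρ ρ′ b pre′≡ post≡ = go
    (prefix-before (ρ.a ∷ ρ.run) b before (free∌ attx′ ρ.run-free) λ { refl → ρ.¬att-y attx′ })
    (prefix-before (ρ′.a ∷ ρ′.run) e before′ (free∌ attx ρ′.run-free) λ { refl → ρ′.¬att-y attx })
    where
    module ρ = Run ρ
    module ρ′ = Run ρ′
    e = ρ′.post ++ ρ.pre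
    free∌ : ∀ {z t l} → Att t → All (FreeNbr z) l → t ∉ₗ l
    free∌ att free t∈ = proj₂ (All.lookup free t∈) att
    before : (ρ.a ∷ ρ.run) ++ ρ.y ∷ ρ.rest ≡ b ++ x′ ∷ e
    before = ≡.trans (≡.sym ρ.splits)
      (≡.trans (cong (_++ ρ.pre) post≡) (++-assoc b (x′ ∷ ρ′.post) ρ.pre))
    before′ : (ρ′.a ∷ ρ′.run) ++ ρ′.y ∷ ρ′.rest ≡ e ++ x ∷ b
    before′ = ≡.trans (≡.sym ρ′.splits)
      (≡.trans (cong (ρ′.post ++_) pre′≡) (≡.sym (++-assoc ρ′.post ρ.pre (x ∷ b))))
    arrangement : C ≡ ρ.pre ++ x ∷ b ++ x′ ∷ ρ′.post
    arrangement = ≡.trans ρ.position (cong (λ t → ρ.pre ++ x ∷ t) post≡)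
    assoc : (x ∷ b ++ x′ ∷ ρ′.post) ++ ρ.pre ≡ x ∷ b ++ x′ ∷ e
    assoc = cong (x ∷_) (++-assoc b (x′ ∷ ρ′.post) ρ.pre)
    cw₁ : ClosedWalk (x ∷ b ++ x′ ∷ e)
    cw₁ = subst ClosedWalk assoc (rotate ρ.pre _ (subst ClosedWalk arrangement cw))
    c↭₁ : x ∷ b ++ x′ ∷ e ↭ C
    c↭₁ = ↭-trans (↭-reflexive (≡.sym assoc))
      (↭-trans (++-comm _ ρ.pre) (↭-reflexive (≡.sym arrangement)))
    go : (∃ λ r → b ≡ (ρ.a ∷ ρ.run) ++ ρ.y ∷ r) → (∃ λ r → e ≡ (ρ′.a ∷ ρ′.run) ++ ρ′.y ∷ r) →
      Separated ρ ρ′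
    go (r , b≡) (r′ , e≡) = O.y≢y′ , O.y≁y′ , O.x≁y′ , O′.x≁y′
      where
      c≡ : x ∷ b ++ x′ ∷ e ≡ x ∷ ((ρ.a ∷ ρ.run) ++ ρ.y ∷ r) ++ x′ ∷ (ρ′.a ∷ ρ′.run) ++ ρ′.y ∷ r′
      c≡ = ≡.cong₂ (λ s t → x ∷ s ++ x′ ∷ t) b≡ e≡
      cw₂ = subst ClosedWalk c≡ cw₁
      c↭₂ = ↭-trans (↭-reflexive (≡.sym c≡)) c↭₁
      p = x ∷ (ρ.a ∷ ρ.run) ++ ρ.y ∷ r
      q = x′ ∷ (ρ′.a ∷ ρ′.run) ++ ρ′.y ∷ r′
      module O = Opposite cw₂ c↭₂ attx attx′ ρ.run-free ρ′.run-free ρ′.¬att-y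
      -- Starting at `x′` swaps the roles and gives that `x′` is not adjacent to the end of the run
      -- of `x`.
      module O′ = Opposite (rotate p q cw₂) (↭-trans (++-comm q p) c↭₂)
        attx′ attx ρ′.run-free ρ.run-free ρ.¬att-y

  separated : ClosedWalk C → ∀ {x x′} → Att x → Att x′ → x ≢ x′ →
    (ρ : Run x) (ρ′ : Run x′) → Separated ρ ρ′
  separated cw attx attx′ x≢x′ ρ ρ′
    with compare-splits (Run.pre ρ) (Run.pre ρ′)
      (≡.trans (≡.sym (Run.position ρ)) (Run.position ρ′)) x≢x′
  ... | inj₁ (b , pre′≡ , post≡) = separated-ordered cw attx attx′ x≢x′ ρ ρ′ b pre′≡ post≡
  ... | inj₂ (b , pre≡ , post′≡) =
    separated-sym ρ′ ρ (separated-ordered cw attx′ attx (x≢x′ ∘ ≡.sym) ρ′ ρ b pre≡ post′≡)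

-- Counting and finite search

unique⇒length≤∣∣ : ∀ {n} {D : Subset n} {l} → Unique l → (∀ {t} → t ∈ₗ l → t ∈ D) → length l ≤ ∣ D ∣
unique⇒length≤∣∣ {l = []}    _          _   = z≤n
unique⇒length≤∣∣ {l = x ∷ l} (x∉l ∷ un) l⊆D =
  ℕ.≤-trans (s≤s (unique⇒length≤∣∣ un λ t∈ → x∈p∧x≢y⇒x∈p-y (l⊆D (there t∈)) (All.lookup x∉l t∈ ∘ ≡.sym)))
            (x∈p⇒∣p-x∣<∣p∣ (l⊆D (here refl)))

-- The first element that fails `P` clashes with any later failure, so the filter drops at most one.
length≤1+filter : ∀ {A : Set} {P Q : A → Set} {R : A → A → Set} (P? : Decidable P) →
  (∀ {i j} → R i j → Q i → Q j → ¬ P i → ¬ P j → ⊥) →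
  ∀ {l} → AllPairs R l → All Q l → length l ≤ suc (length (filter P? l))
length≤1+filter P? clash {[]}    _ _ = z≤n
length≤1+filter P? clash {x ∷ l} (rx ∷ rs) (qx ∷ qs) with P? x
... | yes _  = s≤s (length≤1+filter P? clash rs qs)
... | no ¬px = s≤s (ℕ.≤-reflexive (≡.sym (cong length (filter-all P? (All.tabulate λ {j} j∈ →
  decidable-stable (P? j) (clash (All.lookup rx j∈) qx (All.lookup qs j∈) ¬px))))))

-- Double-negation shift over a finite type; it lets a proof of `⊥` treat attachment as decidable.
¬¬-∀ : ∀ {n} {P : Fin n → Set} → (∀ i → ¬ ¬ P i) → ¬ ¬ (∀ i → P i)
¬¬-∀ {zero}  _   k = k λ ()
¬¬-∀ {suc n} ¬¬P k = ¬¬P zero λ p₀ → ¬¬-∀ (¬¬P ∘ suc) λ ps → k λ { zero → p₀ ; (suc i) → ps i }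

maximum : ∀ {P : ℕ → Set} → Decidable P → ∀ b → (∀ {m} → P m → m ≤ b) → ∃ P →
  ∃ λ m → P m × (∀ {j} → P j → j ≤ m)
maximum P? b bound (m₀ , p₀) with P? b
... | yes pb = b , pb , bound
maximum P? zero    bound (m₀ , p₀) | no ¬pb with bound p₀
... | z≤n = contradiction p₀ ¬pb
maximum P? (suc b) bound ex | no ¬pb = maximum P? b
  (λ pm → ℕ.≤-pred (ℕ.≤∧≢⇒< (bound pm) λ { refl → ¬pb pm })) ex

list-of-length? : ∀ {n} {P : List (Fin n) → Set} → Decidable P → ∀ m → Dec (∃ λ l → length l ≡ m × P l)
list-of-length? P? zero = map′ (λ p → [] , refl , p) (λ { ([] , _ , p) → p }) (P? [])
list-of-length? P? (suc m) = map′
  (λ { (x , l , eq , p) → x ∷ l , cong suc eq , p })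
  (λ { (x ∷ l , eq , p) → x , l , ℕ.suc-injective eq , p })
  (any? λ x → list-of-length? (P? ∘ (x ∷_)) m)

-- Independent sets dominated by connected sets

module Domination {N} (G : Graph N) where
  open Walks G

  private V = Fin N

  Dominates : V → V → Set
  Dominates d i = i ≡ d ⊎ Adj G d i

  Dominates? : ∀ d i → Dec (Dominates d i)
  Dominates? d i = (i ≟ d) ⊎-dec Adj? d i

  DominatedBy : List V → V → Set
  DominatedBy l i = Any (λ d → Dominates d i) l

  DominatedBy? : ∀ l → Decidable (DominatedBy l)
  DominatedBy? l i = Any.any? (λ d → Dominates? d i) l

  Independent : List V → Set
  Independent = AllPairs λ i j → i ≢ j × ¬ Adj G i j

  -- A connected set presented by an order of growth from `z`, newest vertex first, for induction
  -- one vertex at a time.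
  data Tree (z : V) : List V → Set where
    root : Tree z [ z ]
    grow : ∀ {a d l} → Adj G a d → a ∈ₗ l → Tree z l → Tree z (d ∷ l)

  root∈ : ∀ {z l} → Tree z l → z ∈ₗ l
  root∈ root         = here refl
  root∈ (grow _ _ t) = there (root∈ t)

  -- In a claw-free graph the neighbours of d that are not neighbours of a given neighbour a of d
  -- form a clique, so each vertex added to the tree dominates at most one new independent vertex.
  independent<tree : ClawFree G → ∀ {z l} → Tree z l → ∀ {I} → Independent I →
    All (DominatedBy l) I → All (λ i → ¬ Dominates z i) I → length I < length l
  independent<tree cf root [] _ _ = s≤s z≤n
  independent<tree cf root (_ ∷ _) (here d ∷ _) (¬d ∷ _) = contradiction d ¬d
  independent<tree cf {l = d ∷ l} (grow {a} a~d a∈l tree) {I} ind dom ¬dom =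
    s≤s (ℕ.≤-trans (length≤1+filter (DominatedBy? l) clash ind dom)
      (independent<tree cf tree (AllPairs.filter⁺ (DominatedBy? l) ind) (All.all-filter (DominatedBy? l) I)
        (All.filter⁺ (DominatedBy? l) ¬dom)))
    where
    only-d : ∀ {i} → DominatedBy (d ∷ l) i → ¬ DominatedBy l i → Adj G d i
    only-d (here (inj₁ refl)) ¬dom = contradiction (lose a∈l (inj₂ a~d)) ¬dom
    only-d (here (inj₂ d~i))  _    = d~i
    only-d (there dom)        ¬dom = contradiction dom ¬dom
    clash : ∀ {i j} → i ≢ j × ¬ Adj G i j → DominatedBy (d ∷ l) i → DominatedBy (d ∷ l) j →
      ¬ DominatedBy l i → ¬ DominatedBy l j → ⊥
    clash (i≢j , i≁j) domi domj ¬i ¬j = i≁j (claw cf (Adj-sym a~d) (only-d domi ¬i) (only-d domj ¬j)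
      (λ a≡i → ¬i (lose a∈l (inj₁ (≡.sym a≡i)))) (λ a≡j → ¬j (lose a∈l (inj₁ (≡.sym a≡j)))) i≢j
      (λ a~i → ¬i (lose a∈l (inj₂ a~i))) (λ a~j → ¬j (lose a∈l (inj₂ a~j))))

  path-start∈ : ∀ {D u w} → PathIn G D u w → u ∈ D
  path-start∈ (here u∈)     = u∈
  path-start∈ (step u∈ _ _) = u∈

  boundary-edge : ∀ {D l u w} → PathIn G D u w → u ∈ₗ l → w ∉ₗ l →
    ∃₂ λ a d → Adj G a d × a ∈ₗ l × d ∉ₗ l × d ∈ D
  boundary-edge (here _) u∈ w∉ = contradiction u∈ w∉
  boundary-edge {l = l} (step {v = v} _ e p) u∈ w∉ with _∈?_ _≟_ v l
  ... | yes v∈ = boundary-edge p v∈ w∉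
  ... | no  v∉ = _ , v , e , u∈ , v∉ , path-start∈ p

  -- While a vertex of `D` is missing, the path to it from the root leaves the tree along an edge
  -- whose far end can be added. `f` bounds the number of additions still possible.
  spanning-tree : ∀ {D z} → (∀ w → w ∈ D → PathIn G D z w) → ∀ f {l} → ∣ D ∣ ≤ length l + f →
    Tree z l → Unique l → (∀ {t} → t ∈ₗ l → t ∈ D) →
    ∃ λ m → Tree z m × length m ≤ ∣ D ∣ × (∀ {t} → t ∈ D → t ∈ₗ m)
  spanning-tree {D} conn f {l} bound tree un l⊆D
    with any? (λ d → (d ∈ₛ? D) ×-dec ¬? (_∈?_ _≟_ d l))
  ... | no ¬more = l , tree , unique⇒length≤∣∣ un l⊆D ,
                   λ {t} t∈D → decidable-stable (_∈?_ _≟_ t l) λ t∉l → ¬more (t , t∈D , t∉l)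
  ... | yes (w , w∈D , w∉l) with boundary-edge (conn w w∈D) (root∈ tree) w∉l
  ...   | a , d , e , a∈ , d∉ , d∈D = extend f bound
    where
    un′ : Unique (d ∷ l)
    un′ = All.¬Any⇒All¬ l d∉ ∷ un
    l⊆D′ : ∀ {t} → t ∈ₗ d ∷ l → t ∈ D
    l⊆D′ (here refl) = d∈D
    l⊆D′ (there t∈)  = l⊆D t∈
    extend : ∀ f → ∣ D ∣ ≤ length l + f → _
    -- The tree already has at least as many vertices as `D`, so `D` has no room for `d`.
    extend zero    bound = contradiction (unique⇒length≤∣∣ un′ l⊆D′)
      (ℕ.≤⇒≯ (subst (∣ D ∣ ≤_) (ℕ.+-identityʳ _) bound))
    extend (suc f) bound =
      spanning-tree conn f (subst (∣ D ∣ ≤_) (ℕ.+-suc _ f) bound) (grow e a∈ tree) un′ l⊆D′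

  -- Growing `D` from `z` gives a root that dominates nothing in `I`, which makes the bound strict.
  independent<∣D∣ : ClawFree G → ∀ {D z} → z ∈ D → (∀ w → w ∈ D → PathIn G D z w) →
    ∀ {I} → Independent I →
    All (λ i → ∃ λ d → d ∈ D × Dominates d i) I → All (λ i → ¬ Dominates z i) I → length I < ∣ D ∣
  independent<∣D∣ cf {D} z∈D conn ind dom ¬dom
    with spanning-tree conn ∣ D ∣ (ℕ.n≤1+n _) root ([] ∷ []) (λ { (here refl) → z∈D })
  ... | m , tree , m≤ , D⊆m = ℕ.<-≤-trans
    (independent<tree cf tree ind (All.map (λ (d , d∈ , dom) → lose (D⊆m d∈) dom) dom) ¬dom) m≤

-- Dominating sets from criticality

module _ {n} (G : Graph (suc n)) where
  open Walks G
  open Domination G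

  -- What γ_c(G − v) < k ≤ γ_c(G) provides, with D read as a set of vertices of G.
  record AllBut (k : ℕ) (v : Fin (suc n)) : Set where
    field
      D         : Subset (suc n)
      small     : ∣ D ∣ < k
      connected : ∀ u w → u ∈ D → w ∈ D → PathIn G D u w
      dominates : ∀ u → u ≢ v → ∃ λ d → d ∈ D × Dominates d u
      misses    : ∀ {d} → d ∈ D → ¬ Dominates d v

  insertAt-outside : ∀ {m} (D : Subset m) v → ∣ insertAt D v outside ∣ ≡ ∣ D ∣
  insertAt-outside D             zero    = refl
  insertAt-outside (inside  ∷ D) (suc v) = cong suc (insertAt-outside D v)
  insertAt-outside (outside ∷ D) (suc v) = insertAt-outside D v

  allBut : ∀ {k} → VertexCritical k G → ∀ v → AllBut k v
  allBut {k} ((_ , minimal) , critical) v with critical v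
  ... | m , m<k , (D₀ , (dom₀ , (d₀ , d₀∈) , conn₀) , refl) , _ = record
    { D = D ; small = small ; connected = conn ; dominates = dominates ; misses = misses }
    where
    D = insertAt D₀ v outside
    small : ∣ D ∣ < k
    small = subst (_< k) (≡.sym (insertAt-outside D₀ v)) m<k
    lift : ∀ {i} → i ∈ D₀ → punchIn v i ∈ D
    lift {i} i∈ = lookup⇒[]= _ D (≡.trans (insertAt-punchIn D₀ v outside i) ([]=⇒lookup i∈))
    lower : ∀ {i} → punchIn v i ∈ D → i ∈ D₀
    lower {i} i∈ = lookup⇒[]= _ D₀ (≡.trans (≡.sym (insertAt-punchIn D₀ v outside i)) ([]=⇒lookup i∈))
    v∉D : v ∉ D
    v∉D v∈ = case ≡.trans (≡.sym (insertAt-lookup D₀ v outside)) ([]=⇒lookup v∈) of λ ()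
    -- A view of the vertices other than `v`: matching on it rewrites them as `punchIn v i`.
    data Image : Fin (suc n) → Set where
      image : ∀ i → Image (punchIn v i)
    preimage : ∀ {u} → u ≢ v → Image u
    preimage u≢v = subst Image (punchIn-punchOut (u≢v ∘ ≡.sym)) (image _)
    liftPath : ∀ {i j} → PathIn (G -ᵥ v) D₀ i j → PathIn G D (punchIn v i) (punchIn v j)
    liftPath (here i∈)     = here (lift i∈)
    liftPath (step i∈ e p) = step (lift i∈) e (liftPath p)
    conn : ∀ u w → u ∈ D → w ∈ D → PathIn G D u w
    conn u w u∈ w∈ with preimage {u} (λ { refl → v∉D u∈ }) | preimage {w} (λ { refl → v∉D w∈ })
    ... | image i | image j = liftPath (conn₀ i j (lower u∈) (lower w∈))
    dominates : ∀ u → u ≢ v → ∃ λ d → d ∈ D × Dominates d u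
    dominates u u≢v with preimage u≢v
    ... | image i with i ∈ₛ? D₀
    ...   | yes i∈ = _ , lift i∈ , inj₁ refl
    ...   | no i∉ with dom₀ i i∉
    ...     | d , d∈ , e = _ , lift d∈ , inj₂ e
    misses : ∀ {d} → d ∈ D → ¬ Dominates d v
    misses d∈ (inj₁ refl) = v∉D d∈
    -- A neighbour of `v` in `D` would make `D` a connected dominating set of `G` with fewer than
    -- `k` vertices.
    misses {d} d∈ (inj₂ d~v) = ℕ.<⇒≱ small (minimal D (dominating , (_ , lift d₀∈) , conn))
      where
      dominating : Dominating G D
      dominating u u∉ with u ≟ v
      ... | yes refl = d , d∈ , d~v
      ... | no u≢v with dominates u u≢v
      ...   | _ , e∈ , inj₁ refl = contradiction e∈ u∉
      ...   | e , e∈ , inj₂ e~u  = e , e∈ , e~u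

-- A union bound, and the component of `h` off the cycle

∣p∪q∣≤∣p∣+∣q∣ : ∀ {n} (p q : Subset n) → ∣ p ∪ q ∣ ≤ ∣ p ∣ + ∣ q ∣
∣p∪q∣≤∣p∣+∣q∣ []            []            = z≤n
∣p∪q∣≤∣p∣+∣q∣ (outside ∷ p) (outside ∷ q) = ∣p∪q∣≤∣p∣+∣q∣ p q
∣p∪q∣≤∣p∣+∣q∣ (outside ∷ p) (inside  ∷ q) =
  ℕ.≤-trans (s≤s (∣p∪q∣≤∣p∣+∣q∣ p q)) (ℕ.≤-reflexive (≡.sym (ℕ.+-suc ∣ p ∣ ∣ q ∣)))
∣p∪q∣≤∣p∣+∣q∣ (inside  ∷ p) (outside ∷ q) = s≤s (∣p∪q∣≤∣p∣+∣q∣ p q)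
∣p∪q∣≤∣p∣+∣q∣ (inside  ∷ p) (inside  ∷ q) =
  s≤s (ℕ.≤-trans (∣p∪q∣≤∣p∣+∣q∣ p q) (ℕ.+-monoʳ-≤ ∣ p ∣ (ℕ.n≤1+n _)))

module Component {N} (G : Graph N) (C : List (Fin N)) (h : Fin N) (h∉C : h ∉ₗ C) where
  open Walks G

  data Reach : Fin N → Set where
    start : Reach h
    next  : ∀ {u v} → Reach u → Adj G u v → v ∉ₗ C → Reach v

  Reach-off : ∀ {u} → Reach u → u ∉ₗ C
  Reach-off start         = h∉C
  Reach-off (next _ _ v∉) = v∉

  walk-from : ∀ {u} → Reach u → ∃ λ w → Walk h w u × (∀ {t} → t ∈ₗ w → t ∉ₗ C)
  walk-from start = [ h ] , stop h , λ { (here refl) → h∉C }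
  walk-from (next {v = v} r e v∉) with walk-from r
  ... | w , p , off = w ++ [ v ] , p ▸⟨ e ⟩ stop v ,
    λ t∈ → Sum.[ off , (λ { (here refl) → v∉ }) ] (∈-++⁻ w t∈)

  -- Both walks contain `h`, so the second contributes only what comes after it.
  join-at-h : ∀ {u v l m} → Walk u l h → (∀ {t} → t ∈ₗ l → t ∉ₗ C) →
    Walk h m v → (∀ {t} → t ∈ₗ m → t ∉ₗ C) → ∃ λ k → Walk u k v × (∀ {t} → t ∈ₗ k → t ∉ₗ C)
  join-at-h p offp (stop _) _ = _ , p , offp
  join-at-h {l = l} p offp (e ◂ q) offq = _ , p ▸⟨ e ⟩ q ,
    λ t∈ → Sum.[ offp , offq ∘ there ]′ (∈-++⁻ l t∈)

  Reach-link : ∀ {u v} → Reach u → Reach v → ∃ λ w → Walk u w v × Unique w × (∀ {t} → t ∈ₗ w → t ∉ₗ C)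
  Reach-link ru rv with walk-from ru | walk-from rv
  ... | wu , pu , offu | wv , pv , offv
    with join-at-h (reverseʷ pu) (offu ∘ ∈-resp-↭ (↭-reverse wu)) pv offv
  ... | k , p , off with simplify p
  ...   | w , q , un , w⊆k = w , q , un , off ∘ w⊆k

-- Attached vertices and the contradiction

module NonHamiltonian {n k} (G : Graph (suc n)) (k≤5 : k ≤ 5) (clawFree : ClawFree G)
  (3-connected : KConnected 3 G) (critical : VertexCritical k G)
  (C : List (Fin (suc n))) (C-cycle : Walks.Cycle G C)
  (C-longest : ∀ {l} → Walks.Cycle G l → length l ≤ length C)
  (h : Fin (suc n)) (h∉C : h ∉ₗ C)
  where

  open Walks G
  open Domination G
  open Component G C h h∉C
  open LongestCycle G clawFree C (proj₂ C-cycle) C-longest Reach Reach-off Reach-link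

  private V = Fin (suc n)

  -- As long as the path avoids `C` it stays in the component, so the vertex where it first enters
  -- `C` is attached.
  leaves-through-Att : ∀ {D u w} → PathIn G D u w → Reach u → ¬ Reach w → ∃ λ x → Att x × x ∈ D
  leaves-through-Att (here _) ru ¬rw = contradiction ru ¬rw
  leaves-through-Att (step {v = v} _ e p) ru ¬rw with _∈?_ _≟_ v C
  ... | yes v∈ = v , (v∈ , _ , ru , e) , path-start∈ p
  ... | no v∉ = leaves-through-Att p (next ru e v∉) ¬rw

  -- Deleting `S` leaves a path from `h` to `c`, and this path enters `C` outside `S`.
  another-Att : ∀ S → ∣ S ∣ < 3 → (∀ {s} → s ∈ S → s ∈ₗ C) →
    ∀ {c} → c ∈ₗ C → c ∉ S → ∃ λ x → Att x × x ∉ S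
  another-Att S small S⊆C {c} c∈ c∉S
    with leaves-through-Att
      (proj₂ (proj₂ 3-connected S small) h c (x∉p⇒x∈∁p (h∉C ∘ S⊆C)) (x∉p⇒x∈∁p c∉S))
      start (λ r → Reach-off r c∈)
  ... | x , attx , x∈∁S = x , attx , x∈∁p⇒x∉p x∈∁S

  record ThreeAtts : Set where
    field
      {x₁ x₂ x₃} : V
      att₁ : Att x₁
      att₂ : Att x₂
      att₃ : Att x₃
      x₁≢x₂ : x₁ ≢ x₂
      x₁≢x₃ : x₁ ≢ x₃
      x₂≢x₃ : x₂ ≢ x₃

  first-Att : ∃ Att
  first-Att =
    let x , attx , _ = another-Att ∅ (subst (_< 3) (≡.sym (∣⊥∣≡0 (suc n))) (s≤s z≤n))
                         (λ s∈ → contradiction s∈ ∉⊥) (end∈ (proj₁ (proj₂ (proj₂ (proj₁ C-cycle))))) ∉⊥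
    in x , attx

  second-Att : ∀ {x₁} → Att x₁ → ∃ λ x → Att x × x₁ ≢ x
  second-Att {x₁} att₁ =
    let c , c∈ , c≢ = closed-avoids (proj₁ C-cycle) x₁
        x , attx , x∉ = another-Att ⁅ x₁ ⁆ (subst (_< 3) (≡.sym (∣⁅x⁆∣≡1 x₁)) (s≤s (s≤s z≤n)))
          (λ s∈ → subst (_∈ₗ C) (≡.sym (x∈⁅y⁆⇒x≡y x₁ s∈)) (proj₁ att₁)) c∈ (c≢ ∘ x∈⁅y⁆⇒x≡y x₁)
    in x , attx , λ x₁≡x → x∉ (subst (_∈ ⁅ x₁ ⁆) x₁≡x (x∈⁅x⁆ x₁))

  -- The end of the run of `x₁` is unattached, hence a vertex of `C` besides `x₁` and `x₂` towards
  -- which a path from `h` can be followed.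
  third-Att : ∀ {x₁ x₂} → Att x₁ → Att x₂ → Run x₁ → ∃ λ x → Att x × x₁ ≢ x × x₂ ≢ x
  third-Att {x₁} {x₂} att₁ att₂ ρ =
    let x , attx , x∉ = another-Att pair pair-small (proj₁ ∘ pair-att) (y∈C ρ) (Run.¬att-y ρ ∘ pair-att)
    in x , attx , (λ x₁≡x → x∉ (subst (_∈ pair) x₁≡x (x∈p∪q⁺ (inj₁ (x∈⁅x⁆ x₁)))))
                , (λ x₂≡x → x∉ (subst (_∈ pair) x₂≡x (x∈p∪q⁺ (inj₂ (x∈⁅x⁆ x₂)))))
    where
    pair = ⁅ x₁ ⁆ ∪ ⁅ x₂ ⁆
    pair-att : ∀ {s} → s ∈ pair → Att s
    pair-att s∈ = Sum.[ (λ s∈ → subst Att (≡.sym (x∈⁅y⁆⇒x≡y x₁ s∈)) att₁)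
                      , (λ s∈ → subst Att (≡.sym (x∈⁅y⁆⇒x≡y x₂ s∈)) att₂) ]′ (x∈p∪q⁻ ⁅ x₁ ⁆ ⁅ x₂ ⁆ s∈)
    pair-small : ∣ pair ∣ < 3
    pair-small = s≤s (ℕ.≤-trans (∣p∪q∣≤∣p∣+∣q∣ ⁅ x₁ ⁆ ⁅ x₂ ⁆)
      (ℕ.≤-reflexive (≡.cong₂ _+_ (∣⁅x⁆∣≡1 x₁) (∣⁅x⁆∣≡1 x₂))))

  three-atts : (∀ v → Dec (Att v)) → ThreeAtts
  three-atts att? =
    let x₁ , att₁ = first-Att
        x₂ , att₂ , x₁≢x₂ = second-Att att₁
        x₃ , att₃ , x₁≢x₃ , x₂≢x₃ = third-Att att₁ att₂ (run-of att? (proj₁ C-cycle) att₁ att₂ x₁≢x₂)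
    in record { att₁ = att₁ ; att₂ = att₂ ; att₃ = att₃
              ; x₁≢x₂ = x₁≢x₂ ; x₁≢x₃ = x₁≢x₃ ; x₂≢x₃ = x₂≢x₃ }

  module _ (att? : ∀ v → Dec (Att v)) (three : ThreeAtts) where
    open ThreeAtts three

    run : ∀ {x} → Att x → Run x
    run {x} attx with x ≟ x₁
    ... | yes refl = run-of att? (proj₁ C-cycle) attx att₂ x₁≢x₂
    ... | no x≢x₁  = run-of att? (proj₁ C-cycle) attx att₁ x≢x₁

    y : ∀ {x} → Att x → V
    y attx = Run.y (run attx)

    apart : ∀ {x x′} (attx : Att x) (attx′ : Att x′) → x ≢ x′ →
      y attx ≢ y attx′ × ¬ Adj G (y attx) (y attx′)
    apart attx attx′ x≢x′ with separated (proj₁ C-cycle) attx attx′ x≢x′ (run attx) (run attx′)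
    ... | y≢y′ , y≁y′ , _ = y≢y′ , y≁y′

    Att≁y : ∀ {w x} → Att w → (attx : Att x) → ¬ Adj G w (y attx)
    Att≁y {w} {x} attw attx with w ≟ x
    ... | yes refl = Run.x≁y (run attx)
    ... | no w≢x = proj₁ (proj₂ (proj₂ (separated (proj₁ C-cycle) attw attx w≢x (run attw) (run attx))))

    Att≢y : ∀ {w x} → Att w → (attx : Att x) → w ≢ y attx
    Att≢y attw attx refl = Run.¬att-y (run attx) attw

    xs : List V
    xs = x₁ ∷ x₂ ∷ x₃ ∷ []

    ys : List V
    ys = y att₁ ∷ y att₂ ∷ y att₃ ∷ []

    Att-xs : ∀ {x} → x ∈ₗ xs → Att x
    Att-xs (here refl)                 = att₁
    Att-xs (there (here refl))         = att₂
    Att-xs (there (there (here refl))) = att₃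

    ys-independent : Independent ys
    ys-independent =
      (apart att₁ att₂ x₁≢x₂ ∷ apart att₁ att₃ x₁≢x₃ ∷ []) ∷ (apart att₂ att₃ x₂≢x₃ ∷ []) ∷ [] ∷ []

    -- For `v` in `xs`: in the complement graph on the three vertices, `z` is a leaf hanging at `v`.
    -- Not every one of three vertices can have such a leaf.
    record Partner (v : V) : Set where
      field
        {z} : V
        z∈xs : z ∈ₗ xs
        z≢v  : z ≢ v
        z≁v  : ¬ Adj G z v
        z~   : ∀ {w} → w ∈ₗ xs → w ≢ v → w ≢ z → Adj G z w

    partner : ∀ {v} → Att v → Partner v
    partner {v} attv = from-Att (meets-Att (dominates h λ { refl → h∉C (proj₁ attv) }))
      where
      open AllBut (allBut G critical v)

      -- A vertex `d` dominating `h` is attached or in the component. In the second case `D` also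
      -- dominates `y att₁`, from outside the component as `y att₁` is an unattached vertex of `C`;
      -- so `D` contains a path that leaves the component.
      meets-Att : (∃ λ d → d ∈ D × Dominates d h) → ∃ λ z → Att z × z ∈ D
      meets-Att (d , d∈ , dom) = Sum.[ (λ attd → d , attd , d∈) , exit ]′ (nearby dom)
        where
        nearby : Dominates d h → Att d ⊎ Reach d
        nearby (inj₁ refl) = inj₂ start
        nearby (inj₂ d~h) with _∈?_ _≟_ d C
        ... | yes d∈C = inj₁ (d∈C , h , start , Adj-sym d~h)
        ... | no d∉C  = inj₂ (next start (Adj-sym d~h) d∉C)
        exit : Reach d → ∃ λ z → Att z × z ∈ D
        exit rd with dominates (y att₁) (Att≢y attv att₁ ∘ ≡.sym)
        ... | e , e∈ , dom = leaves-through-Att (connected d e d∈ e∈) rd (unreachable dom)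
          where
          unreachable : Dominates e (y att₁) → ¬ Reach e
          unreachable (inj₁ refl) re = Reach-off re (y∈C (run att₁))
          unreachable (inj₂ e~y)  re = Run.¬att-y (run att₁) (y∈C (run att₁) , e , re , e~y)

      from-Att : (∃ λ z → Att z × z ∈ D) → Partner v
      from-Att (z , attz , z∈D) = record
        { z∈xs = decidable-stable (_∈?_ _≟_ z xs) in-xs
        ; z≢v  = λ { refl → misses z∈D (inj₁ refl) }
        ; z≁v  = misses z∈D ∘ inj₂
        ; z~   = λ {w} w∈ w≢v w≢z → decidable-stable (Adj? z w) (near w∈ w≢v w≢z) }
        where
        -- Together with `ys`, `i` would form four independent vertices dominated by `D` but not by
        -- `z`, forcing more than four vertices into `D`; but `D` has fewer than `k ≤ 5`.
        no-fourth : ∀ i → All (λ y → i ≢ y × ¬ Adj G i y) ys → i ≢ v → ¬ Dominates z i → ⊥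
        no-fourth i indep i≢v ¬dom = ℕ.<⇒≱
          (ℕ.<-≤-trans (independent<∣D∣ clawFree z∈D (λ w → connected z w z∈D) (indep ∷ ys-independent)
              (dominates i i≢v ∷ All.map (dominates _) (≢v att₁ ∷ ≢v att₂ ∷ ≢v att₃ ∷ []))
              (¬dom ∷ ¬z att₁ ∷ ¬z att₂ ∷ ¬z att₃ ∷ []))
            (ℕ.≤-pred (ℕ.≤-trans small k≤5)))
          ℕ.≤-refl
          where
          ≢v : ∀ {x} (attx : Att x) → y attx ≢ v
          ≢v attx = Att≢y attv attx ∘ ≡.sym
          ¬z : ∀ {x} (attx : Att x) → ¬ Dominates z (y attx)
          ¬z attx = Sum.[ Att≢y attz attx ∘ ≡.sym , Att≁y attz attx ]
        -- Outside `xs`, `z` has a run of its own, whose end is the fourth vertex.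
        in-xs : z ∉ₗ xs → ⊥
        in-xs z∉ = no-fourth (y attz)
          (apart attz att₁ (λ { refl → z∉ (here refl) }) ∷
           apart attz att₂ (λ { refl → z∉ (there (here refl)) }) ∷
           apart attz att₃ (λ { refl → z∉ (there (there (here refl))) }) ∷ [])
          (Att≢y attv attz ∘ ≡.sym)
          Sum.[ Att≢y attz attz ∘ ≡.sym , Att≁y attz attz ]
        -- Here `w` itself is the fourth vertex: being attached, it is apart from all of `ys`.
        near : ∀ {w} → w ∈ₗ xs → w ≢ v → w ≢ z → ¬ Adj G z w → ⊥
        near {w} w∈ w≢v w≢z z≁w =
          no-fourth w (off att₁ ∷ off att₂ ∷ off att₃ ∷ []) w≢v Sum.[ w≢z , z≁w ]
          where
          off : ∀ {x} (attx : Att x) → w ≢ y attx × ¬ Adj G w (y attx)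
          off attx = Att≢y (Att-xs w∈) attx , Att≁y (Att-xs w∈) attx

    -- If b is the partner of a, then b is adjacent to c, so the partner of c can only be a;
    -- but then a would be adjacent to b.
    no-partners : ⊥
    no-partners with partner att₁ | partner att₂ | partner att₃
    ... | record { z∈xs = here refl ; z≢v = z≢v } | _ | _ = z≢v refl
    ... | record { z∈xs = there (here refl) ; z≁v = x₂≁x₁ ; z~ = x₂~ } | _ | p₃ = go p₃
      where
      go : Partner x₃ → ⊥
      go record { z∈xs = here refl ; z~ = x₁~ } =
        x₂≁x₁ (Adj-sym (x₁~ (there (here refl)) x₂≢x₃ (x₁≢x₂ ∘ ≡.sym)))
      go record { z∈xs = there (here refl) ; z≁v = x₂≁x₃ } =
        x₂≁x₃ (x₂~ (there (there (here refl))) (x₁≢x₃ ∘ ≡.sym) (x₂≢x₃ ∘ ≡.sym))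
      go record { z∈xs = there (there (here refl)) ; z≢v = z≢v } = z≢v refl
    ... | record { z∈xs = there (there (here refl)) ; z≁v = x₃≁x₁ ; z~ = x₃~ } | p₂ | _ = go p₂
      where
      go : Partner x₂ → ⊥
      go record { z∈xs = here refl ; z~ = x₁~ } =
        x₃≁x₁ (Adj-sym (x₁~ (there (there (here refl))) (x₂≢x₃ ∘ ≡.sym) (x₁≢x₃ ∘ ≡.sym)))
      go record { z∈xs = there (here refl) ; z≢v = z≢v } = z≢v refl
      go record { z∈xs = there (there (here refl)) ; z≁v = x₃≁x₂ } =
        x₃≁x₂ (x₃~ (there (here refl)) (x₁≢x₂ ∘ ≡.sym) x₂≢x₃)

  contradictory : ⊥
  -- The goal is `⊥`, so excluded middle may be assumed for attachment at each of the finitely many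
  -- vertices.
  contradictory = ¬¬-∀ {P = Dec ∘ Att} (λ _ → ¬¬-excluded-middle)
    λ att? → no-partners att? (three-atts att?)

-- A longest cycle and the conclusion

module _ {N} (G : Graph N) where
  open Walks G

  Cycle? : Decidable Cycle
  Cycle? l = closedWalk? l ×-dec UniqueDec.unique? _≟_ l

  longest-cycle : ∃ Cycle → ∃ λ C → Cycle C × (∀ {l} → Cycle l → length l ≤ length C)
  longest-cycle (l₀ , cyc₀) with maximum (list-of-length? Cycle?) N bound (length l₀ , l₀ , refl , cyc₀)
    where
    bound : ∀ {m} → (∃ λ l → length l ≡ m × Cycle l) → m ≤ N
    bound (l , refl , _ , un) = subst (length l ≤_) (∣⊤∣≡n N) (unique⇒length≤∣∣ un λ _ → ∈⊤)
  ... | _ , (C , refl , cyc) , max = C , cyc , λ {l} cyc′ → max (l , refl , cyc′)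

  walk⇒consecAdj : ∀ {u x l v} → Walk u (x ∷ l) v → ConsecAdj G (x ∷ l) × last′ x l ≡ v
  walk⇒consecAdj (stop u) = one u , refl
  walk⇒consecAdj {l = y ∷ l} (e ◂ p) with walk-start p
  ... | refl with walk⇒consecAdj p
  ...   | adjs , last≡ = cons e adjs , last≡

  spanning⇒N≤length : ∀ {l} → (∀ v → v ∈ₗ l) → N ≤ length l
  spanning⇒N≤length all∈ = injective⇒≤ {f = λ v → Any.index (all∈ v)}
    λ {u} {v} → index-injective (≡.setoid _) (all∈ u) (all∈ v)

  spanning-cycle⇒Hamiltonian : 3 ≤ N → ∀ {l} → Cycle l → (∀ v → v ∈ₗ l) → Hamiltonian G
  spanning-cycle⇒Hamiltonian 3≤N {[]} ((_ , _ , () , _) , _) _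
  spanning-cycle⇒Hamiltonian 3≤N {x ∷ xs} (cw , un) all∈ with closed-∷ cw
  ... | v , p , e with walk⇒consecAdj p
  -- Spanning at least three vertices rules out the degenerate cycle of length two.
  ...   | adjs , refl = x , xs , un , all∈ , ℕ.≤-trans 3≤N (spanning⇒N≤length all∈) , adjs , e

  edge⇒Cycle : ∀ {u v} → Adj G u v → ∃ Cycle
  edge⇒Cycle {u} {v} e = u ∷ v ∷ [] , (u , v , e ◂ stop v , Adj-sym e) ,
    ((λ { refl → Adj-irrefl e }) ∷ []) ∷ [] ∷ []

  KConnected⇒edge : ∀ {k} → 2 ≤ N → 0 < k → KConnected k G → ∃₂ (Adj G)
  KConnected⇒edge {k} (s≤s (s≤s _)) 0<k (_ , conn)
    with proj₂ (conn ∅ (subst (_< k) (≡.sym (∣⊥∣≡0 N)) 0<k)) zero (suc zero)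
      (x∉p⇒x∈∁p ∉⊥) (x∉p⇒x∈∁p ∉⊥)
  ... | step _ e _ = _ , _ , e

theorem3p8 : (k n : ℕ) → (k ≡ 4 ⊎ k ≡ 5) → (G : Graph (suc n)) →
    KConnected 3 G → VertexCritical k G → ClawFree G → Hamiltonian G
theorem3p8 k n k∈ G conn crit clawFree
  with KConnected⇒edge G (ℕ.≤-trans (s≤s (s≤s z≤n)) (proj₁ conn)) (s≤s z≤n) conn
... | _ , _ , e with longest-cycle G (edge⇒Cycle G e)
...   | C , cyc , longest = spanning-cycle⇒Hamiltonian G (ℕ.<⇒≤ (proj₁ conn)) cyc
  λ v → decidable-stable (_∈?_ _≟_ v C) λ v∉ →
    NonHamiltonian.contradictory G k≤5 clawFree conn crit C cyc longest v v∉
  where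
  k≤5 : k ≤ 5
  k≤5 = Sum.[ (λ { refl → ℕ.n≤1+n 4 }) , (λ { refl → ℕ.≤-refl }) ]′ k∈
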